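{- Let $q$ be a prime power and let $m,\ell\ge1$ be integers with $\ell\mid m$, $m/\ell$ even and $\ell\ne\frac m2$. If $\frac12(m/\ell)$ is odd, then $\Gamma_{q,m}(\ell)$ is a strongly regular graph of Latin square type.
   Context: For a prime power $q$ and integers $m\ge1,\ell\ge0$, $S_{q,m}(\ell)=\{x^{q^\ell+1}:x\in\mathbb F_{q^m}^*\}$ and $\Gamma_{q,m}(\ell)$ is the Cayley graph on $\mathbb F_{q^m}$ with $x\sim y$ iff $y-x\in S_{q,m}(\ell)$. A strongly regular graph is of (pseudo-)Latin square type if its parameters $(v,k,e,d)$ (vertices, valency, common neighbours of adjacent pairs, common neighbours of non-adjacent pairs) are of the form $(n^2,\ t(n-1),\ n-2+(t-1)(t-2),\ t(t-1))$ for some positive integers $n,t$. -}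

module Defs where

open import Level using (0ℓ)
open import Data.Nat using (ℕ; zero; suc; _≤_; _^_) renaming (_+_ to _+ℕ_; _*_ to _*ℕ_; _∸_ to _∸ℕ_)
open import Data.Nat.Primality using (Prime)
open import Data.Product using (Σ; ∃; ∃₂; _×_; _,_; proj₁; proj₂)
open import Data.List using (List; length; filter)
open import Data.List.Membership.Propositional using (_∈_)
open import Data.List.Relation.Unary.Unique.Propositional using (Unique)
open import Data.List.Relation.Unary.Any using (Any; any?; here; there)
open import Data.List.Membership.Propositional.Properties using (∈-lookup)
open import Relation.Nullary using (¬_; Dec; yes; no)
open import Relation.Nullary.Decidable using (_×-dec_; ¬?)
open import Relation.Binary.Definitions using (DecidableEquality)
open import Relation.Binary.PropositionalEquality using (_≡_; refl; subst)
open import Algebra.Structures using (IsCommutativeRing)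

PrimePower : ℕ → Set
PrimePower q = ∃₂ λ p k → Prime p × 1 ≤ k × q ≡ p ^ k

Even : ℕ → Set
Even n = ∃ λ j → n ≡ 2 *ℕ j

Odd : ℕ → Set
Odd n = ∃ λ j → n ≡ suc (2 *ℕ j)

record FiniteField (N : ℕ) : Set₁ where
  field
    Carrier : Set
    _+_ _*_ : Carrier → Carrier → Carrier
    -_ : Carrier → Carrier
    0# 1# : Carrier
    isCommutativeRing : IsCommutativeRing _≡_ _+_ _*_ -_ 0# 1#
    0≢1 : ¬ (0# ≡ 1#)
    inverse : ∀ x → ¬ (x ≡ 0#) → ∃ λ y → x * y ≡ 1#
    _≟_ : DecidableEquality Carrier
    elements : List Carrier
    elements-unique : Unique elements
    elements-complete : ∀ x → x ∈ elements
    cardinality : length elements ≡ N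

  infixl 6 _+_
  infixl 7 _*_

  _-_ : Carrier → Carrier → Carrier
  x - y = x + (- y)

  pow : Carrier → ℕ → Carrier
  pow x zero = 1#
  pow x (suc n) = x * pow x n

  count : {P : Carrier → Set} → (∀ x → Dec (P x)) → ℕ
  count P? = length (filter P? elements)

  ∃? : {P : Carrier → Set} → (∀ x → Dec (P x)) → Dec (∃ P)
  ∃? {P} P? with any? P? elements
  ... | yes a = let (x , _ , px) = find a in yes (x , px)
    where
      find : ∀ {xs} → Any P xs → Σ Carrier (λ x → x ∈ xs × P x)
      find (here px) = _ , here refl , px
      find (there a) = let (x , m , px) = find a in x , there m , px
  ... | no ¬a = no λ { (x , px) → ¬a (lift (elements-complete x) px) }
    where
      lift : ∀ {x xs} → x ∈ xs → P x → Any P xs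
      lift (here refl) px = here px
      lift (there m) px = there (lift m px)

module _ {N : ℕ} (F : FiniteField N) where
  open FiniteField F

  InS : ℕ → Carrier → Set
  InS e d = ∃ λ w → ¬ (w ≡ 0#) × pow w e ≡ d

  InS? : ∀ e d → Dec (InS e d)
  InS? e d = ∃? (λ w → ¬? (w ≟ 0#) ×-dec (pow w e ≟ d))

  CayleyAdj : (q ℓ : ℕ) → Carrier → Carrier → Set
  CayleyAdj q ℓ x y = InS (q ^ ℓ +ℕ 1) (y - x)

  CayleyAdj? : (q ℓ : ℕ) → ∀ x y → Dec (CayleyAdj q ℓ x y)
  CayleyAdj? q ℓ x y = InS? (q ^ ℓ +ℕ 1) (y - x)

  IsSRG : (Adj : Carrier → Carrier → Set) → (∀ x y → Dec (Adj x y))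
        → ℕ → ℕ → ℕ → ℕ → Set
  IsSRG Adj Adj? v k e d =
      (∀ x → ¬ Adj x x)
    × (∀ x y → Adj x y → Adj y x)
    × N ≡ v
    × (∀ x → count (Adj? x) ≡ k)
    × (∀ x y → ¬ (x ≡ y) → Adj x y
         → count (λ z → Adj? x z ×-dec Adj? y z) ≡ e)
    × (∀ x y → ¬ (x ≡ y) → ¬ Adj x y
         → count (λ z → Adj? x z ×-dec Adj? y z) ≡ d)

  -- Strongly regular of (pseudo-)Latin square type: parameters
  -- (n², t(n-1), n-2+(t-1)(t-2), t(t-1)) for positive integers n, t.
  -- (e = n-2+(t-1)(t-2) is written as e + 2 = n + (t-1)(t-2) to avoid
  -- truncated subtraction; t-1, t-2 appear only inside a product which is
  -- ≥ 0 for t ≥ 1, and n-1 ≥ 0 for n ≥ 1.)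
  IsSRGLatinSquareType : (Adj : Carrier → Carrier → Set)
        → (∀ x y → Dec (Adj x y)) → Set
  IsSRGLatinSquareType Adj Adj? =
    Σ ℕ λ n → Σ ℕ λ t → Σ ℕ λ e → 1 ≤ n × 1 ≤ t ×
      e +ℕ 2 ≡ n +ℕ (t ∸ℕ 1) *ℕ (t ∸ℕ 2) ×
      IsSRG Adj Adj? (n *ℕ n) (t *ℕ (n ∸ℕ 1)) e (t *ℕ (t ∸ℕ 1))

{-# OPTIONS --safe #-}
-- Write Q = q^ℓ, n = Q^s with s = m/(2ℓ) odd, N = n² and t = (n + 1)/(Q + 1).  The set S of (Q+1)-th
-- powers is {x : x^(t(n-1)) = 1}; hence it is stable under the nonzero elements of the subfield
-- K = {x : x^n = x} of order n, and is a union of t punctured lines of the affine plane F = K².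
-- The line of a nonzero x is determined by its slope x^(n-1), so that x ∈ S iff x^(n-1) is one of
-- the t-th roots of unity.  Lines through 0 and c of distinct slopes meet in exactly one point, so
-- counting the points w with w and w - c in S by the slope of w gives the Latin square parameters.
module Submission where

open import Defs
open import Level using (0ℓ)
open import Algebra.Bundles using (CommutativeRing; CommutativeMonoid)
open import Data.Empty using (⊥-elim)
open import Data.Fin using (Fin; zero; suc; fromℕ; inject₁)
open import Data.Fin.Properties using (toℕ-fromℕ; toℕ-inject₁; toℕ<n)
open import Data.List using (List; []; _∷_; _++_; length; filter; map; foldr)
open import Data.List.Properties using (length-++; length-map; length-++-sucʳ)
open import Data.List.Membership.Propositional using (_∈_)
open import Data.List.Membership.Propositional.Properties
  using (∈-filter⁺; ∈-filter⁻; ∈-map⁺; ∈-map⁻; ∈-++⁺ˡ; ∈-++⁺ʳ; ∈-++⁻; ∈-∃++)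
open import Data.List.Membership.Propositional.Properties.WithK using (unique∧set⇒bag)
open import Data.List.Relation.Binary.BagAndSetEquality using (∼bag⇒↭)
open import Data.List.Relation.Binary.Permutation.Propositional using (_↭_; ↭⇒↭ₛ; ↭-sym)
open import Data.List.Relation.Binary.Permutation.Propositional.Properties
  using (shift; ↭-length; ∈-resp-↭)
import Data.List.Relation.Binary.Permutation.Setoid.Properties as PermS
open import Data.List.Relation.Binary.Subset.Propositional using (_⊆_)
import Data.List.Relation.Unary.All as All
open import Data.List.Relation.Unary.AllPairs using ([]; _∷_)
open import Data.List.Relation.Unary.Any using (here; there)
open import Data.List.Relation.Unary.Unique.Propositional using (Unique)
open import Data.List.Relation.Unary.Unique.Propositional.Properties
  using (filter⁺; map⁺; ++⁺; Unique[x∷xs]⇒x∉xs)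
open import Data.Nat
  using (ℕ; zero; suc; z≤n; s≤s; _≤_; _<_; _∸_; _^_; _/_; _!; NonZero;
         >-nonZero; ≢-nonZero⁻¹; nonTrivial⇒n>1)
  renaming (_+_ to _+ℕ_; _*_ to _*ℕ_)
import Data.Nat.Properties as ℕ
open import Data.Nat.Combinatorics using (_C_; nCn≡1; nCk≡n!/k![n-k]!; k![n∸k]!∣n!)
open import Data.Nat.Divisibility using (_∣_; divides; ∣⇒≤; ∣1⇒≡1; m∣m*n)
open import Data.Nat.DivMod using (m/n*n≡m; m*n/n≡m)
open import Data.Nat.Primality
  using (Prime; euclidsLemma; prime⇒nonZero; prime⇒nonTrivial; ¬prime[1])
open import Data.Nat.Tactic.RingSolver using (solve-∀)
open import Data.Product using (∃; _×_; _,_; proj₁; proj₂)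
open import Data.Sum using (_⊎_; inj₁; inj₂)
open import Data.Vec using (Vec; []; _∷_; replicate)
open import Function using (_∘_; mk⇔)
open import Relation.Binary.Definitions using (DecidableEquality)
open import Relation.Binary.PropositionalEquality
  using (_≡_; _≢_; refl; sym; trans; cong; cong₂; subst; setoid; module ≡-Reasoning)
open import Relation.Nullary using (¬_; Dec; yes; no)
open import Relation.Nullary.Decidable using (¬?)

-- Duplicate-free lists and counting.

module _ {A : Set} where

  unique-⊆⊇⇒↭ : {xs ys : List A} → Unique xs → Unique ys → xs ⊆ ys → ys ⊆ xs → xs ↭ ys
  unique-⊆⊇⇒↭ ux uy i j = ∼bag⇒↭ (unique∧set⇒bag ux uy (mk⇔ i j))

  unique-⊆⇒length-≤ : {xs ys : List A} → Unique xs → xs ⊆ ys → length xs ≤ length ys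
  unique-⊆⇒length-≤ {[]} _ _ = z≤n
  unique-⊆⇒length-≤ {x ∷ xs} u@(_ ∷ uxs) i with ∈-∃++ (i (here refl))
  ... | as , bs , refl = subst (suc (length xs) ≤_) (sym (length-++-sucʳ as x bs))
    (s≤s (unique-⊆⇒length-≤ uxs xs⊆))
    where
    xs⊆ : xs ⊆ as ++ bs
    xs⊆ z∈xs with ∈-resp-↭ (shift x as bs) (i (there z∈xs))
    ... | here refl = ⊥-elim (Unique[x∷xs]⇒x∉xs u z∈xs)
    ... | there z∈ = z∈

-- A count is witnessed by an enumeration, so `P` need not be decidable and counts can be carried
-- along bijections, including those between different types.
record Card {A : Set} (P : A → Set) (n : ℕ) : Set where
  field
    list     : List A
    unique   : Unique list
    sound    : ∀ {x} → x ∈ list → P x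
    complete : ∀ {x} → P x → x ∈ list
    size     : length list ≡ n

module _ {A : Set} where

  private
    variable
      P Q : A → Set
      m n : ℕ

  card-resp : m ≡ n → Card P m → Card P n
  card-resp refl c = c

  card-cong : (∀ {x} → P x → Q x) → (∀ {x} → Q x → P x) → Card P n → Card Q n
  card-cong f g c = record
    { list = list; unique = unique; sound = f ∘ sound; complete = complete ∘ g; size = size }
    where open Card c

  card-∅ : (∀ {x} → ¬ P x) → Card P 0
  card-∅ ¬p = record
    { list = []; unique = []; sound = λ (); complete = ⊥-elim ∘ ¬p; size = refl }

  card-⊎ : Card P m → Card Q n → (∀ {x} → P x → ¬ Q x) → Card (λ x → P x ⊎ Q x) (m +ℕ n)
  card-⊎ c d disjoint = record
    { list = C.list ++ D.list
    ; unique = ++⁺ C.unique D.unique λ (p , q) → disjoint (C.sound p) (D.sound q)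
    ; sound = λ z → case (∈-++⁻ C.list z)
    ; complete = λ { (inj₁ p) → ∈-++⁺ˡ (C.complete p)
                   ; (inj₂ q) → ∈-++⁺ʳ C.list (D.complete q) }
    ; size = trans (length-++ C.list) (cong₂ _+ℕ_ C.size D.size)
    }
    where
    module C = Card c
    module D = Card d
    case : ∀ {x} → x ∈ C.list ⊎ x ∈ D.list → _ ⊎ _
    case (inj₁ p) = inj₁ (C.sound p)
    case (inj₂ q) = inj₂ (D.sound q)

  card-remove : ∀ {a} → P a → Card P (suc n) → Card (λ x → P x × x ≢ a) n
  card-remove {P = P} {n = n} {a = a} pa c with ∈-∃++ (Card.complete c pa)
  ... | as , bs , eq = record
    { list = as ++ bs
    ; unique = tail unique′
    ; sound = λ z → sound (subst (_ ∈_) (sym eq) (∈-resp-↭ (↭-sym (shift a as bs)) (there z)))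
                  , λ { refl → Unique[x∷xs]⇒x∉xs unique′ z }
    ; complete = λ (px , x≢a) → drop x≢a (∈-resp-↭ (shift a as bs) (subst (_ ∈_) eq (complete px)))
    ; size = ℕ.suc-injective (trans (sym (length-++-sucʳ as a bs)) (trans (cong length (sym eq)) size))
    }
    where
    open Card c
    unique′ : Unique (a ∷ as ++ bs)
    unique′ = PermS.Unique-resp-↭ (setoid A) (↭⇒↭ₛ (shift a as bs)) (subst Unique eq unique)
    tail : ∀ {x} {xs : List A} → Unique (x ∷ xs) → Unique xs
    tail (_ ∷ u) = u
    drop : ∀ {x xs} → x ≢ a → x ∈ a ∷ xs → x ∈ xs
    drop x≢a (here x≡a) = ⊥-elim (x≢a x≡a)
    drop x≢a (there x∈) = x∈

  card-0⇒∅ : Card P 0 → ∀ {x} → ¬ P x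
  card-0⇒∅ record { list = []; complete = complete } p with () ← complete p

  card-unique : Card P m → Card P n → m ≡ n
  card-unique c d = trans (sym C.size) (trans (↭-length
    (unique-⊆⊇⇒↭ C.unique D.unique (D.complete ∘ C.sound) (C.complete ∘ D.sound))) D.size)
    where
    module C = Card c
    module D = Card d

-- The maps are inverse to each other only on `P` and `Q`, so operations meaningful only there, such
-- as division, may be given as total functions.
card-↔ : {A B : Set} {P : A → Set} {Q : B → Set} {n : ℕ} (f : A → B) (g : B → A) →
  (∀ {x} → P x → Q (f x)) → (∀ {y} → Q y → P (g y)) →
  (∀ {x} → P x → g (f x) ≡ x) → (∀ {y} → Q y → f (g y) ≡ y) →
  Card P n → Card Q n
card-↔ {A} {P = P} {Q = Q} f g fP gQ gf fg c = record
  { list = map f list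
  ; unique = map-unique list unique (λ {_} → sound)
  ; sound = λ z → let (x , x∈ , eq) = ∈-map⁻ f z in subst Q (sym eq) (fP (sound x∈))
  ; complete = λ q → subst (_∈ _) (fg q) (∈-map⁺ f (complete (gQ q)))
  ; size = trans (length-map f list) size
  }
  where
  open Card c
  -- `f` need not be injective on all of `A`; distinctness of the images comes from the left inverse
  -- `g`, valid on the members of the list.
  map-unique : ∀ xs → Unique xs → (∀ {x} → x ∈ xs → P x) → Unique (map f xs)
  map-unique [] _ _ = []
  map-unique (x ∷ xs) u@(_ ∷ us) s = All.tabulate fresh ∷ map-unique xs us (s ∘ there)
    where
    fresh : ∀ {y} → y ∈ map f xs → f x ≢ y
    fresh y∈ refl with ∈-map⁻ f y∈
    ... | z , z∈ , eq = Unique[x∷xs]⇒x∉xs u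
      (subst (_∈ xs) (trans (sym (gf (s (there z∈)))) (trans (cong g (sym eq)) (gf (s (here refl))))) z∈)

card-fibres : {A B : Set} {P : A → Set} {Q : B → Set} {t d : ℕ} (f : A → B) →
  Card Q t → (∀ {x} → P x → Q (f x)) → (∀ {u} → Q u → Card (λ x → P x × f x ≡ u) d) →
  Card P (t *ℕ d)
card-fibres {A} {B} {P} {Q} {d = d} f c PQ fibre =
  card-cong proj₁ (λ p → p , complete (PQ p))
    (card-resp (cong (_*ℕ d) size) (over list unique sound))
  where
  open Card c
  over : (us : List B) → Unique us → (∀ {u} → u ∈ us → Q u) →
    Card (λ x → P x × f x ∈ us) (length us *ℕ d)
  over [] _ _ = card-∅ λ ()
  over (u ∷ us) uu@(_ ∷ uus) s = card-cong
    (λ { (inj₁ (p , e)) → p , here e ; (inj₂ (p , i)) → p , there i })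
    (λ { (p , here e) → inj₁ (p , e) ; (p , there i) → inj₂ (p , i) })
    (card-⊎ (fibre (s (here refl))) (over us uus (s ∘ there))
      λ { (_ , refl) (_ , i) → Unique[x∷xs]⇒x∉xs uu i })

module _ {A B : Set} (_≟_ : DecidableEquality B) (f : A → B) where

  -- Splitting off the fibre over the head of `ys` costs at most `d` elements. Read backwards, this
  -- bounds the size of an image from below.
  length-≤-fibres : {d : ℕ} (xs : List A) (ys : List B) → Unique xs → (∀ {x} → x ∈ xs → f x ∈ ys) →
    (∀ y {zs} → Unique zs → (∀ {z} → z ∈ zs → z ∈ xs × f z ≡ y) → length zs ≤ d) →
    length xs ≤ length ys *ℕ d
  length-≤-fibres [] _ _ _ _ = z≤n
  length-≤-fibres (x ∷ _) [] _ into _ with () ← into (here refl)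
  length-≤-fibres {d} xs@(_ ∷ _) (y ∷ ys) u into bound = begin
    length xs                                 ≤⟨ unique-⊆⇒length-≤ u split ⟩
    length (filter on xs ++ filter off xs)    ≡⟨ length-++ (filter on xs) ⟩
    length (filter on xs) +ℕ length (filter off xs)
      ≤⟨ ℕ.+-mono-≤ (bound y (filter⁺ on u) (∈-filter⁻ on {xs = xs}))
                  (length-≤-fibres (filter off xs) ys (filter⁺ off u) into′
                    λ z uz i → bound z uz λ w →
                      let (a , b) = i w in proj₁ (∈-filter⁻ off {xs = xs} a) , b) ⟩
    d +ℕ length ys *ℕ d                         ∎
    where
    open ℕ.≤-Reasoning
    on = λ x → f x ≟ y
    off = λ x → ¬? (f x ≟ y)
    split : xs ⊆ filter on xs ++ filter off xs
    split {x} x∈ with f x ≟ y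
    ... | yes e = ∈-++⁺ˡ (∈-filter⁺ on x∈ e)
    ... | no ¬e = ∈-++⁺ʳ (filter on xs) (∈-filter⁺ off x∈ ¬e)
    into′ : ∀ {x} → x ∈ filter off xs → f x ∈ ys
    into′ x∈ with ∈-filter⁻ off {xs = xs} x∈
    ... | x∈xs , ≢y with into x∈xs
    ... | here e = ⊥-elim (≢y e)
    ... | there i = i

-- Prime divisors of factorials and binomial coefficients.

prime∣!⇒≤ : ∀ {p} → Prime p → ∀ n → p ∣ n ! → p ≤ n
prime∣!⇒≤ pr zero p∣1 = ⊥-elim (¬prime[1] (subst Prime (∣1⇒≡1 p∣1) pr))
prime∣!⇒≤ pr (suc n) p∣ with euclidsLemma (suc n) (n !) pr p∣
... | inj₁ d = ∣⇒≤ d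
... | inj₂ d = ℕ.m≤n⇒m≤1+n (prime∣!⇒≤ pr n d)

n∣n! : ∀ n → .{{NonZero n}} → n ∣ n !
n∣n! (suc n) = m∣m*n (n !)

-- The prime divides p! = (p C k) k! (p - k)!, but neither factorial on the right, as both k and p -
-- k are below p.
prime∣binomial : ∀ {p k} → Prime p → 0 < k → k < p → p ∣ p C k
prime∣binomial {p} {k} pr 0<k k<p with euclidsLemma (p C k) (k ! *ℕ (p ∸ k) !) pr p∣
  where
  instance _ = ℕ._!*_!≢0 k (p ∸ k)
  instance _ = prime⇒nonZero pr
  p∣ : p ∣ (p C k) *ℕ (k ! *ℕ (p ∸ k) !)
  p∣ = subst (p ∣_) (sym (trans (cong (_*ℕ (k ! *ℕ (p ∸ k) !)) (nCk≡n!/k![n-k]! (ℕ.<⇒≤ k<p)))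
                               (m/n*n≡m (k![n∸k]!∣n! (ℕ.<⇒≤ k<p))))) (n∣n! p)
... | inj₁ d = d
... | inj₂ d with euclidsLemma (k !) ((p ∸ k) !) pr d
... | inj₁ d′ = ⊥-elim (ℕ.<⇒≱ k<p (prime∣!⇒≤ pr k d′))
... | inj₂ d′ = ⊥-elim (ℕ.<⇒≱ (ℕ.∸-monoʳ-< 0<k (ℕ.<⇒≤ k<p)) (prime∣!⇒≤ pr (p ∸ k) d′))

-- Field arithmetic and roots of polynomials.

module FieldTheory {N : ℕ} (F : FiniteField N) where
  -- Without fixity declarations both minus signs would bind tighter than multiplication.
  open FiniteField F public renaming (-_ to infix 8 -_; _-_ to infixl 6 _-_)

  commutativeRing : CommutativeRing 0ℓ 0ℓ
  commutativeRing = record { isCommutativeRing = isCommutativeRing }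

  open CommutativeRing commutativeRing public
    using (+-comm; +-identityˡ; +-identityʳ; *-assoc; *-comm; *-identityˡ; *-identityʳ;
           zeroˡ; zeroʳ; -‿inverseˡ; -‿inverseʳ; +-monoid; +-group;
           +-commutativeMonoid; *-commutativeMonoid; commutativeSemiring; semiring; ring)
  open import Algebra.Properties.Group +-group public
    using ()
    renaming (x∙y⁻¹≈ε⇒x≈y to x-y≡0⇒x≡y; x≈y⇒x∙y⁻¹≈ε to x≡y⇒x-y≡0; ∙-cancelˡ to +-cancelˡ;
              ∙-cancelʳ to +-cancelʳ; ⁻¹-anti-homo-// to -[x-y]≡y-x)
  open import Algebra.Properties.Ring ring public
    using (-‿distribˡ-*; -‿distribʳ-*; -1*x≈-x)
    renaming (x[y-z]≈xy-xz to *-distribˡ--; [y-z]x≈yx-zx to *-distribʳ--)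
  open import Algebra.Properties.CommutativeSemiring.Exp commutativeSemiring
    using (^-assocʳ; ^-distrib-*) renaming (_^_ to _^F_)
  open import Algebra.Properties.Semiring.Mult semiring
    using (×1-homo-*; ×-assoc-*) renaming (_×_ to _·_)
  open import Algebra.Properties.Monoid.Sum +-monoid using (sum; sum-init-last)
  import Algebra.Properties.CommutativeSemiring.Binomial commutativeSemiring as Binomial
  open import Algebra.Solver.Ring.NaturalCoefficients.Default commutativeSemiring public
    using (solve; _:=_; _:+_; _:*_)

  Additive : (Carrier → Carrier) → Set
  Additive f = ∀ x y → f (x + y) ≡ f x + f y

  *-cancelˡ : ∀ a {x y} → a ≢ 0# → a * x ≡ a * y → x ≡ y
  *-cancelˡ a {x} {y} a≢0 eq with inverse a a≢0
  ... | b , ab≡1 = trans (sym (undo x)) (trans (cong (b *_) eq) (undo y))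
    where
    undo : ∀ z → b * (a * z) ≡ z
    undo z = trans (solve 3 (λ a b z → b :* (a :* z) := (a :* b) :* z) refl a b z)
                   (trans (cong (_* z) ab≡1) (*-identityˡ z))

  x*y≡0⇒y≡0 : ∀ {x y} → x ≢ 0# → x * y ≡ 0# → y ≡ 0#
  x*y≡0⇒y≡0 {x} x≢0 e = *-cancelˡ x x≢0 (trans e (sym (zeroʳ x)))

  *-≢0 : ∀ {x y} → x ≢ 0# → y ≢ 0# → x * y ≢ 0#
  *-≢0 x≢0 y≢0 e = y≢0 (x*y≡0⇒y≡0 x≢0 e)

  y+[x-y]≡x : ∀ x y → y + (x - y) ≡ x
  y+[x-y]≡x x y = trans (solve 3 (λ x y -y → y :+ (x :+ -y) := x :+ (y :+ -y)) refl x y (- y))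
                     (trans (cong (x +_) (-‿inverseʳ y)) (+-identityʳ x))

  pow-^ : ∀ x n → pow x n ≡ x ^F n
  pow-^ x zero = refl
  pow-^ x (suc n) = cong (x *_) (pow-^ x n)

  pow-* : ∀ x m n → pow (pow x m) n ≡ pow x (m *ℕ n)
  pow-* x m n rewrite pow-^ x (m *ℕ n) | pow-^ x m | pow-^ (x ^F m) n = ^-assocʳ x m n

  pow-distrib-* : ∀ x y n → pow (x * y) n ≡ pow x n * pow y n
  pow-distrib-* x y n rewrite pow-^ (x * y) n | pow-^ x n | pow-^ y n = ^-distrib-* x y n

  pow-1# : ∀ n → pow 1# n ≡ 1#
  pow-1# zero = refl
  pow-1# (suc n) = trans (*-identityˡ _) (pow-1# n)

  pow-0# : ∀ n → .{{NonZero n}} → pow 0# n ≡ 0#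
  pow-0# (suc n) = zeroˡ _

  pow-≢0 : ∀ {x} n → x ≢ 0# → pow x n ≢ 0#
  pow-≢0 zero x≢0 e = 0≢1 (sym e)
  pow-≢0 (suc n) x≢0 = *-≢0 x≢0 (pow-≢0 n x≢0)

  pow≡1⇒≢0 : ∀ {x} n → .{{NonZero n}} → pow x n ≡ 1# → x ≢ 0#
  pow≡1⇒≢0 n e refl = 0≢1 (trans (sym (pow-0# n)) e)

  -- The coefficient vector c₀ ∷ … ∷ c_{k-1} stands for the monic X^k + c_{k-1} X^{k-1} + … + c₀.
  eval : ∀ {k} → Vec Carrier k → Carrier → Carrier
  eval [] x = 1#
  eval (c ∷ cs) x = c + x * eval cs x

  -- Synthetic division by X - r: the coefficients are the intermediate values of Horner's scheme at
  -- r.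
  quotient : ∀ {k} → Carrier → Vec Carrier (suc k) → Vec Carrier k
  quotient r (c ∷ []) = []
  quotient r (c ∷ cs@(_ ∷ _)) = eval cs r ∷ quotient r cs

  -- The point is r + d rather than x with d = x - r, which makes this a semiring identity.
  eval-quotient : ∀ {k} r d (cs : Vec Carrier (suc k)) →
    eval cs (r + d) ≡ eval cs r + d * eval (quotient r cs) (r + d)
  eval-quotient r d (c ∷ []) =
    solve 4 (λ c r d o → c :+ (r :+ d) :* o := (c :+ r :* o) :+ d :* o) refl c r d 1#
  eval-quotient r d (c ∷ cs@(_ ∷ _)) = trans (cong (λ z → c + (r + d) * z) (eval-quotient r d cs))
    (solve 5 (λ c r d p q → c :+ (r :+ d) :* (p :+ d :* q) := (c :+ r :* p) :+ d :* (p :+ (r :+ d) :* q))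
      refl c r d (eval cs r) (eval (quotient r cs) (r + d)))

  -- Divide by X - r for the first root r. Every other listed root x has x - r nonzero, hence is a
  -- root of the quotient, whose degree is one less.
  length-roots : ∀ {k} (cs : Vec Carrier k) {xs} → Unique xs →
    (∀ {x} → x ∈ xs → eval cs x ≡ 0#) → length xs ≤ k
  length-roots cs {[]} _ _ = z≤n
  length-roots [] {x ∷ xs} _ root = ⊥-elim (0≢1 (sym (root (here refl))))
  length-roots cs@(_ ∷ _) {r ∷ xs} u@(_ ∷ us) root = s≤s (length-roots (quotient r cs) us root′)
    where
    root′ : ∀ {x} → x ∈ xs → eval (quotient r cs) x ≡ 0#
    root′ {x} x∈ = x*y≡0⇒y≡0 x-r≢0 (+-cancelˡ (eval cs r) _ _ (begin
      eval cs r + (x - r) * eval (quotient r cs) x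
        ≡⟨ cong (λ z → eval cs r + (x - r) * eval (quotient r cs) z) (y+[x-y]≡x x r) ⟨
      eval cs r + (x - r) * eval (quotient r cs) (r + (x - r)) ≡⟨ eval-quotient r (x - r) cs ⟨
      eval cs (r + (x - r))  ≡⟨ cong (eval cs) (y+[x-y]≡x x r) ⟩
      eval cs x              ≡⟨ root (there x∈) ⟩
      0#                     ≡⟨ root (here refl) ⟨
      eval cs r              ≡⟨ +-identityʳ _ ⟨
      eval cs r + 0#         ∎))
      where
      open ≡-Reasoning
      x-r≢0 : x - r ≢ 0#
      x-r≢0 e = Unique[x∷xs]⇒x∉xs u (subst (_∈ xs) (x-y≡0⇒x≡y x r e) x∈)

  eval-0s : ∀ k x → eval (replicate k 0#) x ≡ pow x k
  eval-0s zero x = refl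
  eval-0s (suc k) x = trans (+-identityˡ _) (cong (x *_) (eval-0s k x))

  length-pow-fibre : ∀ k .{{_ : NonZero k}} a {xs} → Unique xs →
    (∀ {x} → x ∈ xs → pow x k ≡ a) → length xs ≤ k
  -- The vector encodes X^(k+1) - a, whose leading coefficient is implicit.
  length-pow-fibre (suc k) a u root = length-roots (- a ∷ replicate k 0#) u λ {x} x∈ →
    trans (cong (- a +_) (trans (cong (x *_) (eval-0s k x)) (root x∈))) (-‿inverseˡ a)

  -- Lagrange's theorem for the multiplicative and the additive group.

  nonzero : List Carrier
  nonzero = filter (λ x → ¬? (x ≟ 0#)) elements

  nonzero-unique : Unique nonzero
  nonzero-unique = filter⁺ _ elements-unique

  ∈-nonzero : ∀ {x} → x ≢ 0# → x ∈ nonzero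
  ∈-nonzero = ∈-filter⁺ _ (elements-complete _)

  nonzero-≢0 : ∀ {x} → x ∈ nonzero → x ≢ 0#
  nonzero-≢0 x∈ = proj₂ (∈-filter⁻ _ {xs = elements} x∈)

  card-filter : {P : Carrier → Set} (P? : ∀ x → Dec (P x)) → Card P (count P?)
  card-filter P? = record
    { list = filter P? elements
    ; unique = filter⁺ P? elements-unique
    ; sound = λ x∈ → proj₂ (∈-filter⁻ P? {xs = elements} x∈)
    ; complete = ∈-filter⁺ P? (elements-complete _)
    ; size = refl
    }

  card⇒count : {P : Carrier → Set} {n : ℕ} (P? : ∀ x → Dec (P x)) → Card P n → count P? ≡ n
  card⇒count P? = card-unique (card-filter P?)

  length-nonzero : suc (length nonzero) ≡ N
  length-nonzero = trans (card-unique
    (card-cong (λ _ → elements-complete _) (λ {x} _ → dec x)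
      (card-⊎ (record { list = 0# ∷ [] ; unique = All.[] ∷ [] ; sound = λ { (here e) → e }
                      ; complete = here ; size = refl })
              (card-filter (λ x → ¬? (x ≟ 0#))) λ z nz → nz z))
    (record { list = elements ; unique = elements-unique
            ; sound = λ x → x ; complete = λ x → x ; size = refl }))
    cardinality
    where
    dec : ∀ x → x ≡ 0# ⊎ x ≢ 0#
    dec x with x ≟ 0#
    ... | yes e = inj₁ e
    ... | no ne = inj₂ ne

  pow-∏ : ∀ a xs → foldr _*_ 1# (map (a *_) xs) ≡ pow a (length xs) * foldr _*_ 1# xs
  pow-∏ a [] = sym (*-identityˡ 1#)
  pow-∏ a (x ∷ xs) = trans (cong (a * x *_) (pow-∏ a xs))
    (solve 4 (λ a x p q → (a :* x) :* (p :* q) := (a :* p) :* (x :* q)) refl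
      a x (pow a (length xs)) (foldr _*_ 1# xs))

  ∏-≢0 : ∀ xs → (∀ {x} → x ∈ xs → x ≢ 0#) → foldr _*_ 1# xs ≢ 0#
  ∏-≢0 [] _ = 0≢1 ∘ sym
  ∏-≢0 (x ∷ xs) nz = *-≢0 (nz (here refl)) (∏-≢0 xs (nz ∘ there))

  -- Multiplication by `a` permutes the nonzero elements. Comparing the product of all of them
  -- before and after leaves this power of `a`, as the product is nonzero.
  pow-card : ∀ {a} → a ≢ 0# → pow a (length nonzero) ≡ 1#
  pow-card {a} a≢0 with inverse a a≢0
  ... | b , ab≡1 = *-cancelˡ π (∏-≢0 nonzero nonzero-≢0) (begin
    π * pow a (length nonzero)          ≡⟨ *-comm _ _ ⟩
    pow a (length nonzero) * π          ≡⟨ pow-∏ a nonzero ⟨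
    foldr _*_ 1# (map (a *_) nonzero)
      ≡⟨ PermS.foldr-commMonoid (setoid Carrier)
           (CommutativeMonoid.isCommutativeMonoid *-commutativeMonoid) (↭⇒↭ₛ permuted) ⟩
    π                                   ≡⟨ *-identityʳ π ⟨
    π * 1#                              ∎)
    where
    open ≡-Reasoning
    π = foldr _*_ 1# nonzero
    b≢0 : b ≢ 0#
    b≢0 refl = 0≢1 (trans (sym (zeroʳ a)) ab≡1)
    permuted : map (a *_) nonzero ↭ nonzero
    permuted = unique-⊆⊇⇒↭ (map⁺ (*-cancelˡ a a≢0) nonzero-unique) nonzero-unique
      (λ z → let (x , x∈ , eq) = ∈-map⁻ (a *_) z in
        subst (_∈ nonzero) (sym eq) (∈-nonzero (*-≢0 a≢0 (nonzero-≢0 x∈))))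
      (λ {z} z∈ → subst (_∈ map (a *_) nonzero)
        (trans (sym (*-assoc a b z)) (trans (cong (_* z) ab≡1) (*-identityˡ z)))
        (∈-map⁺ (a *_) (∈-nonzero (*-≢0 b≢0 (nonzero-≢0 z∈)))))

  ·-∑ : ∀ a xs → foldr _+_ 0# (map (a +_) xs) ≡ length xs · a + foldr _+_ 0# xs
  ·-∑ a [] = sym (+-identityˡ 0#)
  ·-∑ a (x ∷ xs) = trans (cong (a + x +_) (·-∑ a xs))
    (solve 4 (λ a x p q → (a :+ x) :+ (p :+ q) := (a :+ p) :+ (x :+ q)) refl
      a x (length xs · a) (foldr _+_ 0# xs))

  -- The additive counterpart: translation by `a` permutes the field, and the sum of all elements
  -- cancels.
  N·a≡0 : ∀ a → N · a ≡ 0#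
  N·a≡0 a = +-cancelʳ ς _ _ (begin
    N · a + ς                           ≡⟨ cong (λ n → n · a + ς) cardinality ⟨
    length elements · a + ς             ≡⟨ ·-∑ a elements ⟨
    foldr _+_ 0# (map (a +_) elements)
      ≡⟨ PermS.foldr-commMonoid (setoid Carrier)
           (CommutativeMonoid.isCommutativeMonoid +-commutativeMonoid) (↭⇒↭ₛ permuted) ⟩
    ς                                   ≡⟨ +-identityˡ ς ⟨
    0# + ς                              ∎)
    where
    open ≡-Reasoning
    ς = foldr _+_ 0# elements
    permuted : map (a +_) elements ↭ elements
    permuted = unique-⊆⊇⇒↭ (map⁺ (+-cancelˡ a _ _) elements-unique) elements-unique
      (λ _ → elements-complete _)
      (λ {z} _ → subst (_∈ map (a +_) elements) (y+[x-y]≡x z a) (∈-map⁺ (a +_) (elements-complete (z - a))))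

  pow-· : ∀ p j → (p ^ j) · 1# ≡ pow (p · 1#) j
  pow-· p zero = +-identityʳ 1#
  pow-· p (suc j) = trans (×1-homo-* p (p ^ j)) (cong (p · 1# *_) (pow-· p j))

  pow≡0⇒≡0 : ∀ x j → pow x j ≡ 0# → x ≡ 0#
  pow≡0⇒≡0 x j e with x ≟ 0#
  ... | yes x≡0 = x≡0
  ... | no x≢0 = ⊥-elim (pow-≢0 j x≢0 e)

  -- The characteristic and the Frobenius map.

  module Characteristic {p j : ℕ} (prime : Prime p) (N≡p^j : N ≡ p ^ j) where

    -- The j-th power of p · 1 is N · 1 = 0, and a field has no nilpotent elements other than 0.
    p·1≡0 : p · 1# ≡ 0#
    p·1≡0 = pow≡0⇒≡0 _ j (trans (sym (pow-· p j)) (trans (cong (_· 1#) (sym N≡p^j)) (N·a≡0 1#)))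

    ∣⇒·≡0 : ∀ {n} a → p ∣ n → n · a ≡ 0#
    ∣⇒·≡0 a (divides k refl) = begin
      (k *ℕ p) · a                ≡⟨ cong ((k *ℕ p) ·_) (*-identityˡ a) ⟨
      (k *ℕ p) · (1# * a)         ≡⟨ ×-assoc-* (k *ℕ p) 1# a ⟨
      ((k *ℕ p) · 1#) * a         ≡⟨ cong (_* a) (×1-homo-* k p) ⟩
      ((k · 1#) * (p · 1#)) * a   ≡⟨ cong (λ z → ((k · 1#) * z) * a) p·1≡0 ⟩
      ((k · 1#) * 0#) * a         ≡⟨ cong (_* a) (zeroʳ _) ⟩
      0# * a                      ≡⟨ zeroˡ a ⟩
      0#                          ∎
      where open ≡-Reasoning

    sum-0 : ∀ {n} (f : Fin n → Carrier) → (∀ i → f i ≡ 0#) → sum f ≡ 0#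
    sum-0 {zero} f z = refl
    sum-0 {suc n} f z = trans (cong₂ _+_ (z zero) (sum-0 (f ∘ suc) (z ∘ suc))) (+-identityˡ 0#)

    pow-p-+ : Additive (λ x → pow x p)
    pow-p-+ x y rewrite pow-^ (x + y) p | pow-^ x p | pow-^ y p =
      trans (Binomial.theorem p x y) (expand p refl)
      where
      open ≡-Reasoning
      -- The exponent is generalised to `n` so that matching it as a successor exposes the first and
      -- last terms of the expansion.
      expand : ∀ n → n ≡ p → Binomial.binomialExpansion x y n ≡ x ^F n + y ^F n
      expand zero refl = ⊥-elim (≢-nonZero⁻¹ 0 {{prime⇒nonZero prime}} refl)
      expand (suc n) refl = begin
        term zero + sum (λ i → term (suc i))
          ≡⟨ cong (term zero +_) (sum-init-last (λ i → term (suc i))) ⟩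
        term zero + (sum (λ i → term (suc (inject₁ i))) + term (suc (fromℕ n)))
          ≡⟨ cong₂ (λ a b → a + (b + term (suc (fromℕ n)))) first (sum-0 _ middle) ⟩
        y ^F suc n + (0# + term (suc (fromℕ n)))
          ≡⟨ cong (y ^F suc n +_) (trans (+-identityˡ _) last) ⟩
        y ^F suc n + x ^F suc n   ≡⟨ +-comm _ _ ⟩
        x ^F suc n + y ^F suc n   ∎
        where
        term = Binomial.binomialTerm x y (suc n)
        first : term zero ≡ y ^F suc n
        first = trans (+-identityʳ _) (*-identityˡ _)
        -- The index `suc (inject₁ i)` lies strictly between 0 and p, so p divides the binomial
        -- coefficient.
        middle : ∀ i → term (suc (inject₁ i)) ≡ 0#
        middle i = ∣⇒·≡0 _ (prime∣binomial prime (s≤s z≤n)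
          (s≤s (subst (_< n) (sym (toℕ-inject₁ i)) (toℕ<n i))))
        last : term (suc (fromℕ n)) ≡ x ^F suc n
        last rewrite toℕ-fromℕ n | nCn≡1 (suc n) | ℕ.n∸n≡0 n =
          trans (+-identityʳ _) (*-identityʳ _)

    frobenius-+ : ∀ i → Additive (λ x → pow x (p ^ i))
    frobenius-+ zero x y = trans (*-identityʳ _) (sym (cong₂ _+_ (*-identityʳ x) (*-identityʳ y)))
    frobenius-+ (suc i) x y = begin
      pow (x + y) (p *ℕ p ^ i)                      ≡⟨ pow-* _ p _ ⟨
      pow (pow (x + y) p) (p ^ i)                   ≡⟨ cong (λ z → pow z (p ^ i)) (pow-p-+ x y) ⟩
      pow (pow x p + pow y p) (p ^ i)               ≡⟨ frobenius-+ i _ _ ⟩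
      pow (pow x p) (p ^ i) + pow (pow y p) (p ^ i) ≡⟨ cong₂ _+_ (pow-* x p _) (pow-* y p _) ⟩
      pow x (p *ℕ p ^ i) + pow y (p *ℕ p ^ i)       ∎
      where open ≡-Reasoning

  -- Powers and roots of unity.

  -- The roots of X^k - 1 are at most k in number, and the e-th powers, all among them, at least
  -- (N - 1) / e = k.
  module Powers {e k : ℕ} .{{_ : NonZero e}} .{{_ : NonZero k}} (e*k : suc (k *ℕ e) ≡ N) where

    private
      roots powers : List Carrier
      roots = filter (λ x → pow x k ≟ 1#) elements
      powers = filter (InS? F e) elements

      length≡ : length nonzero ≡ k *ℕ e
      length≡ = ℕ.suc-injective (trans length-nonzero (sym e*k))

      length-powers : k ≤ length powers
      length-powers = ℕ.*-cancelʳ-≤ k (length powers) e (subst (_≤ length powers *ℕ e) length≡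
        (length-≤-fibres _≟_ (λ x → pow x e) nonzero powers nonzero-unique
          (λ x∈ → ∈-filter⁺ _ (elements-complete _) (_ , nonzero-≢0 x∈ , refl))
          (λ y u s → length-pow-fibre e y u (proj₂ ∘ s))))

    InS⇒pow≡1 : ∀ {x} → InS F e x → pow x k ≡ 1#
    InS⇒pow≡1 (w , w≢0 , refl) = begin
      pow (pow w e) k       ≡⟨ pow-* w e k ⟩
      pow w (e *ℕ k)        ≡⟨ cong (pow w) (trans (ℕ.*-comm e k) (sym length≡)) ⟩
      pow w (length nonzero) ≡⟨ pow-card w≢0 ⟩
      1#                    ∎
      where open ≡-Reasoning

    pow≡1⇒InS : ∀ {x} → pow x k ≡ 1# → InS F e x
    pow≡1⇒InS {x} x^k≡1 with InS? F e x
    ... | yes s = s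
    -- A root outside `powers` would make k + 1 distinct roots of X^k - 1.
    ... | no ¬s = ⊥-elim (ℕ.<⇒≱ (s≤s length-powers)
      (length-pow-fibre k 1# {x ∷ powers} (All.tabulate fresh ∷ filter⁺ _ elements-unique) λ where
        (here refl) → x^k≡1
        (there y∈) → InS⇒pow≡1 (proj₂ (∈-filter⁻ (InS? F e) {xs = elements} y∈))))
      where
      fresh : ∀ {y} → y ∈ powers → x ≢ y
      fresh y∈ refl = ¬s (proj₂ (∈-filter⁻ (InS? F e) {xs = elements} y∈))

    card-roots-of-unity : Card (λ x → pow x k ≡ 1#) k
    card-roots-of-unity = card-resp (ℕ.≤-antisym upper lower) (card-filter (λ x → pow x k ≟ 1#))
      where
      upper : length roots ≤ k
      upper = length-pow-fibre k 1# (filter⁺ _ elements-unique)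
        λ x∈ → proj₂ (∈-filter⁻ (λ x → pow x k ≟ 1#) {xs = elements} x∈)
      lower : k ≤ length roots
      lower = ℕ.≤-trans length-powers (unique-⊆⇒length-≤ (filter⁺ _ elements-unique)
        λ x∈ → ∈-filter⁺ _ (elements-complete _)
          (InS⇒pow≡1 (proj₂ (∈-filter⁻ (InS? F e) {xs = elements} x∈))))

-- Conjugation, slopes and lines of the affine plane.

[r+1]²≡1+r[r+2] : ∀ r → suc r *ℕ suc r ≡ suc (r *ℕ suc (suc r))
[r+1]²≡1+r[r+2] = solve-∀

t[re]≡r[te] : ∀ r t e → t *ℕ (r *ℕ e) ≡ r *ℕ (t *ℕ e)
t[re]≡r[te] = solve-∀

-- Here r = n - 1 and e = Q + 1, and dir x is the slope of the line through 0 and x.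
module LatinSquareGraph {N : ℕ} (F : FiniteField N) (r t e : ℕ)
  .{{_ : NonZero r}} .{{_ : NonZero t}} .{{_ : NonZero e}}
  (N≡n² : N ≡ suc r *ℕ suc r) (t*e : t *ℕ e ≡ suc (suc r))
  (σ-+ : FieldTheory.Additive F (λ x → FiniteField.pow F x (suc r)))
  where

  open FieldTheory F

  -- `σ` is the conjugation of F over the subfield K. The line of slope u through 0 is the
  -- eigenspace given by `σ x ≡ u * x`.
  σ dir : Carrier → Carrier
  σ x = pow x (suc r)
  dir x = pow x r

  S Slope : Carrier → Set
  S = InS F e
  Slope u = pow u t ≡ 1#

  instance
    _ = ℕ.m*n≢0 r t
    _ = ℕ.m*n≢0 r e
    _ = ℕ.m*n≢0 t e

  private
    factors : ∀ {d} → d ≡ r *ℕ (t *ℕ e) → suc d ≡ N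
    factors refl = trans (cong (λ z → suc (r *ℕ z)) t*e) (trans (sym ([r+1]²≡1+r[r+2] r)) (sym N≡n²))

  -- The factorisation N - 1 = r t e is read in three ways: the members of `S` are the r t-th roots
  -- of unity, the slopes of `S` the t-th, the nonzero elements of K the r-th.
  module S-powers = Powers {e} {r *ℕ t} (factors (ℕ.*-assoc r t e))
  module Slopes = Powers {r *ℕ e} {t} (factors (t[re]≡r[te] r t e))
  module Scalars = Powers {t *ℕ e} {r} (factors refl)

  S⇒Slope : ∀ {x} → S x → Slope (dir x)
  S⇒Slope {x} s = trans (pow-* x r t) (S-powers.InS⇒pow≡1 s)

  Slope⇒S : ∀ {x} → Slope (dir x) → S x
  Slope⇒S {x} s = S-powers.pow≡1⇒InS (trans (sym (pow-* x r t)) s)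

  S⇒≢0 : ∀ {x} → S x → x ≢ 0#
  S⇒≢0 s = pow≡1⇒≢0 (r *ℕ t) (S-powers.InS⇒pow≡1 s)

  σ-dir : ∀ x → σ x ≡ dir x * x
  σ-dir x = *-comm x (dir x)

  σ≡⇒dir≡ : ∀ {x u} → x ≢ 0# → σ x ≡ u * x → dir x ≡ u
  σ≡⇒dir≡ {x} {u} x≢0 eq = *-cancelˡ x x≢0 (trans eq (*-comm u x))

  σ-* : ∀ x y → σ (x * y) ≡ σ x * σ y
  σ-* x y = pow-distrib-* x y (suc r)

  σ-0 : σ 0# ≡ 0#
  σ-0 = zeroˡ _

  -- Conjugating twice raises to the power n² = N, and x^N = x by Lagrange's theorem.
  σ-σ : ∀ x → σ (σ x) ≡ x
  σ-σ x with x ≟ 0#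
  ... | yes refl = trans (cong σ σ-0) σ-0
  ... | no x≢0 = begin
    pow (pow x (suc r)) (suc r)     ≡⟨ pow-* x (suc r) (suc r) ⟩
    pow x (suc r *ℕ suc r)          ≡⟨ cong (pow x) {y = suc (length nonzero)}
                                         (trans (sym N≡n²) (sym length-nonzero)) ⟩
    x * pow x (length nonzero)      ≡⟨ cong (x *_) (pow-card x≢0) ⟩
    x * 1#                          ≡⟨ *-identityʳ x ⟩
    x                               ∎
    where open ≡-Reasoning

  -- Additivity suffices, with no case distinction on the parity of the exponent.
  σ-neg : ∀ x → σ (- x) ≡ - σ x
  σ-neg x = +-cancelˡ (σ x) _ _ (begin
    σ x + σ (- x)   ≡⟨ σ-+ x (- x) ⟨
    σ (x - x)       ≡⟨ cong σ (-‿inverseʳ x) ⟩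
    σ 0#            ≡⟨ σ-0 ⟩
    0#              ≡⟨ -‿inverseʳ (σ x) ⟨
    σ x - σ x       ∎)
    where open ≡-Reasoning

  σ-- : ∀ x y → σ (x - y) ≡ σ x - σ y
  σ-- x y = trans (σ-+ x (- y)) (cong (σ x +_) (σ-neg y))

  x≢y⇒x-y≢0 : ∀ {x y} → x ≢ y → x - y ≢ 0#
  x≢y⇒x-y≢0 {x} {y} x≢y e = x≢y (x-y≡0⇒x≡y x y e)

  eigen-- : ∀ {u x y} → σ x ≡ u * x → σ y ≡ u * y → σ (x - y) ≡ u * (x - y)
  eigen-- {u} {x} {y} p q = trans (σ-- x y) (trans (cong₂ _-_ p q) (sym (*-distribˡ-- u x y)))

  -≢0 : ∀ {x} → x ≢ 0# → - x ≢ 0#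
  -≢0 {x} x≢0 e = x≢0 (trans (sym (+-identityʳ x)) (trans (cong (x +_) (sym e)) (-‿inverseʳ x)))

  exchange : ∀ {a b c d} → a - b ≡ c - d → a - c ≡ b - d
  exchange {a} {b} {c} {d} e = begin
    a - c               ≡⟨ +-identityʳ _ ⟨
    (a - c) + 0#        ≡⟨ cong (a - c +_) (-‿inverseˡ b) ⟨
    (a - c) + (- b + b) ≡⟨ solve 4 (λ a b -b -c → (a :+ -c) :+ (-b :+ b) := (a :+ -b) :+ (b :+ -c)) refl
                             a b (- b) (- c) ⟩
    (a - b) + (b - c)   ≡⟨ cong (_+ (b - c)) e ⟩
    (c - d) + (b - c)   ≡⟨ solve 4 (λ b c -c -d → (c :+ -d) :+ (b :+ -c) := (b :+ -d) :+ (c :+ -c)) refl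
                             b c (- c) (- d) ⟩
    (b - d) + (c - c)   ≡⟨ cong (b - d +_) (-‿inverseʳ c) ⟩
    (b - d) + 0#        ≡⟨ +-identityʳ _ ⟩
    b - d               ∎
    where open ≡-Reasoning

  -- Negation preserves each line through 0, hence the slope. This makes adjacency symmetric.
  S-neg : ∀ {x} → S x → S (- x)
  S-neg {x} s = Slope⇒S (subst Slope (sym dir-neg) (S⇒Slope s))
    where
    dir-neg : dir (- x) ≡ dir x
    dir-neg = σ≡⇒dir≡ (-≢0 (S⇒≢0 s)) (trans (σ-neg x) (trans (cong -_ (σ-dir x)) (-‿distribʳ-* (dir x) x)))

  -- The product is the norm u^(n+1), and t divides n + 1. Thus conjugation inverts slopes.
  slope-σ : ∀ {u} → Slope u → u * σ u ≡ 1#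
  slope-σ {u} s = begin
    pow u (suc (suc r))   ≡⟨ cong (pow u) t*e ⟨
    pow u (t *ℕ e)        ≡⟨ pow-* u t e ⟨
    pow (pow u t) e       ≡⟨ cong (λ z → pow z e) s ⟩
    pow 1# e              ≡⟨ pow-1# e ⟩
    1#                    ∎
    where open ≡-Reasoning

  -- If w lies on the line of slope u through 0 and on the line of slope v through c, then
  -- (u - v) w = σ c - v c, and this equation conversely determines the intersection point.
  meet⇒ : ∀ {u v w c} → σ w ≡ u * w → σ (w - c) ≡ v * (w - c) → (u - v) * w ≡ σ c - v * c
  meet⇒ {u} {v} {w} {c} p q = trans (*-distribʳ-- w u v) (exchange (begin
    u * w - σ c     ≡⟨ cong (_- σ c) p ⟨
    σ w - σ c       ≡⟨ σ-- w c ⟨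
    σ (w - c)       ≡⟨ q ⟩
    v * (w - c)     ≡⟨ *-distribˡ-- v w c ⟩
    v * w - v * c   ∎))
    where open ≡-Reasoning

  -- Conjugation inverts u and v, so it sends u - v to 1/u - 1/v = -(u - v)/(uv); denominators are
  -- cleared.
  slope-diff : ∀ {u v} → Slope u → Slope v → u * (v * σ (u - v)) ≡ - (u - v)
  slope-diff {u} {v} su sv = begin
    u * (v * σ (u - v))               ≡⟨ cong (λ z → u * (v * z)) (σ-- u v) ⟩
    u * (v * (σ u - σ v))             ≡⟨ solve 4 (λ u v a b → u :* (v :* (a :+ b)) := (u :* a) :* v :+ u :* (v :* b))
                                           refl u v (σ u) (- σ v) ⟩
    u * σ u * v + u * (v * - σ v)     ≡⟨ cong₂ (λ a b → a * v + u * b) (slope-σ su)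
                                           (trans (sym (-‿distribʳ-* v (σ v))) (cong -_ (slope-σ sv))) ⟩
    1# * v + u * - 1#                 ≡⟨ cong₂ _+_ (*-identityˡ v) (trans (*-comm u (- 1#)) (-1*x≈-x u)) ⟩
    v - u                             ≡⟨ -[x-y]≡y-x u v ⟨
    - (u - v)                         ∎
    where open ≡-Reasoning

  -- Likewise conjugation sends σ c - v c to c - (σ c)/v = -(σ c - v c)/v.
  slope-shift : ∀ {v} c → Slope v → v * σ (σ c - v * c) ≡ - (σ c - v * c)
  slope-shift {v} c sv = begin
    v * σ (σ c - v * c)               ≡⟨ cong (v *_) (σ-- (σ c) (v * c)) ⟩
    v * (σ (σ c) - σ (v * c))         ≡⟨ cong₂ (λ a b → v * (a - b)) (σ-σ c) (σ-* v c) ⟩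
    v * (c - σ v * σ c)               ≡⟨ *-distribˡ-- v c _ ⟩
    v * c - v * (σ v * σ c)           ≡⟨ cong (λ z → v * c - z) (trans (sym (*-assoc v (σ v) (σ c)))
                                           (trans (cong (_* σ c) (slope-σ sv)) (*-identityˡ _))) ⟩
    v * c - σ c                       ≡⟨ -[x-y]≡y-x (σ c) (v * c) ⟨
    - (σ c - v * c)                   ∎
    where open ≡-Reasoning

  module Meet {u v c w : Carrier} (su : Slope u) (sv : Slope v) (u≢v : u ≢ v)
    (meets : (u - v) * w ≡ σ c - v * c) where
    open ≡-Reasoning

    -- Here w is the quotient of σ c - v c by u - v. Conjugation multiplies the numerator by -1/v
    -- and the denominator by -1/(uv), hence w by u.
    σ-meet : σ w ≡ u * w
    σ-meet = *-cancelˡ (- (u - v)) (-≢0 (x≢y⇒x-y≢0 u≢v)) (begin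
      - (u - v) * σ w               ≡⟨ cong (_* σ w) (slope-diff su sv) ⟨
      u * (v * σ (u - v)) * σ w     ≡⟨ solve 4 (λ u v d w → (u :* (v :* d)) :* w := u :* (v :* (d :* w))) refl
                                       u v (σ (u - v)) (σ w) ⟩
      u * (v * (σ (u - v) * σ w))   ≡⟨ cong (λ z → u * (v * z)) (trans (sym (σ-* (u - v) w)) (cong σ meets)) ⟩
      u * (v * σ (σ c - v * c))     ≡⟨ cong (u *_) (slope-shift c sv) ⟩
      u * - (σ c - v * c)           ≡⟨ cong (λ z → u * - z) meets ⟨
      u * - ((u - v) * w)           ≡⟨ cong (u *_) (-‿distribˡ-* (u - v) w) ⟩
      u * (- (u - v) * w)           ≡⟨ solve 3 (λ u d w → u :* (d :* w) := d :* (u :* w)) refl u (- (u - v)) w ⟩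
      - (u - v) * (u * w)           ∎)

    σ-meet- : σ (w - c) ≡ v * (w - c)
    σ-meet- = begin
      σ (w - c)       ≡⟨ σ-- w c ⟩
      σ w - σ c       ≡⟨ cong (_- σ c) σ-meet ⟩
      u * w - σ c     ≡⟨ exchange (trans (sym (*-distribʳ-- w u v)) meets) ⟩
      v * w - v * c   ≡⟨ *-distribˡ-- v w c ⟨
      v * (w - c)     ∎

  -- The value 0 at 0 makes division total, so that `meet` and scaling by 1/c are plain functions,
  -- as `card-↔` requires.
  reciprocal : Carrier → Carrier
  reciprocal x with x ≟ 0#
  ... | yes _ = 0#
  ... | no x≢0 = proj₁ (inverse x x≢0)

  *-reciprocal : ∀ {x} → x ≢ 0# → x * reciprocal x ≡ 1#
  *-reciprocal {x} x≢0 with x ≟ 0#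
  ... | yes x≡0 = ⊥-elim (x≢0 x≡0)
  ... | no x≢0′ = proj₂ (inverse x x≢0′)

  *-divide : ∀ {x} y → x ≢ 0# → x * (reciprocal x * y) ≡ y
  *-divide {x} y x≢0 = trans (sym (*-assoc x _ y)) (trans (cong (_* y) (*-reciprocal x≢0)) (*-identityˡ y))

  -- Common neighbours of 0 and c.

  module _ {c : Carrier} (c≢0 : c ≢ 0#) where

    Common : Carrier → Set
    Common w = S w × S (w - c)

    -- For u and v distinct, the solution of the equation in `meet⇒`: the intersection of the line
    -- of slope u through 0 and the line of slope v through c.
    meet : Carrier → Carrier → Carrier
    meet u v = reciprocal (u - v) * (σ c - v * c)

    σ≢slope : ∀ {v} → v ≢ dir c → σ c ≢ v * c
    σ≢slope v≢ eq = v≢ (sym (σ≡⇒dir≡ c≢0 eq))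

    -- A point w on the line of slope u is determined by the slope v of w - c. The value v = u is
    -- excluded because the parallel through c misses the line, and v = `dir c` because that line
    -- meets it only in 0.
    card-transversal : ∀ {u n} → Slope u → u ≢ dir c → Card (λ v → (Slope v × v ≢ u) × v ≢ dir c) n →
      Card (λ w → Common w × dir w ≡ u) n
    card-transversal {u} su u≢ = card-↔ (meet u) (λ w → dir (w - c)) to from
      (λ ((sv , v≢u) , v≢) → proj₂ (meet-dirs sv v≢u v≢))
      (λ cw → let ((sv , v≢u) , v≢) = from cw in
        *-cancelˡ _ (x≢y⇒x-y≢0 (v≢u ∘ sym)) (trans (*-divide _ (x≢y⇒x-y≢0 (v≢u ∘ sym))) (sym (line cw))))
      where
      meet-dirs : ∀ {v} → Slope v → v ≢ u → v ≢ dir c → dir (meet u v) ≡ u × dir (meet u v - c) ≡ v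
      meet-dirs {v} sv v≢u v≢ = σ≡⇒dir≡ w≢0 M.σ-meet , σ≡⇒dir≡ w-c≢0 M.σ-meet-
        where
        meets : (u - v) * meet u v ≡ σ c - v * c
        meets = *-divide _ (x≢y⇒x-y≢0 (v≢u ∘ sym))
        module M = Meet {c = c} su sv (v≢u ∘ sym) meets
        -- If the lines met in 0, then v would be the slope of c.
        w≢0 : meet u v ≢ 0#
        w≢0 e = x≢y⇒x-y≢0 (σ≢slope v≢) (trans (sym meets) (trans (cong ((u - v) *_) e) (zeroʳ _)))
        -- If they met in c, then u would be the slope of c.
        w-c≢0 : meet u v - c ≢ 0#
        w-c≢0 e = σ≢slope u≢ (subst (λ z → σ z ≡ u * z) (x-y≡0⇒x≡y _ _ e) M.σ-meet)

      to : ∀ {v} → (Slope v × v ≢ u) × v ≢ dir c → Common (meet u v) × dir (meet u v) ≡ u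
      to ((sv , v≢u) , v≢) = let (p , q) = meet-dirs sv v≢u v≢ in
        (Slope⇒S (subst Slope (sym p) su) , Slope⇒S (subst Slope (sym q) sv)) , p

      line : ∀ {w} → Common w × dir w ≡ u → (u - dir (w - c)) * w ≡ σ c - dir (w - c) * c
      line {w} (_ , refl) = meet⇒ (σ-dir w) (σ-dir (w - c))

      from : ∀ {w} → Common w × dir w ≡ u → (Slope (dir (w - c)) × dir (w - c) ≢ u) × dir (w - c) ≢ dir c
      from {w} cw@((sw , sw-c) , refl) = (S⇒Slope sw-c , v≢u) , v≢
        where
        -- For v = u the equation of `line` reduces to σ c = u c, so c would have slope u.
        v≢u : dir (w - c) ≢ dir w
        v≢u e = σ≢slope u≢ (x-y≡0⇒x≡y _ _ (trans (cong (λ z → σ c - z * c) (sym e)) (trans (sym (line cw))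
          (trans (cong (λ z → (dir w - z) * w) e) (trans (cong (_* w) (-‿inverseʳ (dir w))) (zeroˡ w))))))
        -- For v = `dir c` the right-hand side of `line` vanishes, forcing w = 0.
        v≢ : dir (w - c) ≢ dir c
        v≢ e = S⇒≢0 sw (x*y≡0⇒y≡0 (x≢y⇒x-y≢0 (v≢u ∘ sym)) (trans (line cw)
          (x≡y⇒x-y≡0 (trans (σ-dir c) (cong (_* c) (sym e))))))

    -- The points in question are c x with x in K, x nonzero and x distinct from 1, since x = 1
    -- gives w = c. This leaves r - 1 of the r nonzero scalars.
    card-parallel : ∀ {n} → r ≡ suc n → S c → Card (λ w → Common w × dir w ≡ dir c) n
    card-parallel {n} refl sc = card-↔ (c *_) (reciprocal c *_) to from
      (λ _ → *-cancelˡ c c≢0 (*-divide _ c≢0)) (λ _ → *-divide _ c≢0)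
      (card-remove (pow-1# r) Scalars.card-roots-of-unity)
      where
      open ≡-Reasoning
      σ-1 : σ 1# ≡ 1# * 1#
      σ-1 = trans (pow-1# (suc r)) (sym (*-identityˡ 1#))
      to : ∀ {x} → dir x ≡ 1# × x ≢ 1# → Common (c * x) × dir (c * x) ≡ dir c
      to {x} (dx , x≢1) = (along x≢0 σx , subst S c*[x-1] (along (x≢y⇒x-y≢0 x≢1) (eigen-- σx σ-1)))
        , dir-along dx
        where
        x≢0 : x ≢ 0#
        x≢0 = pow≡1⇒≢0 r dx
        σx : σ x ≡ 1# * x
        σx = trans (σ-dir x) (cong (_* x) dx)
        dir-along : ∀ {y} → dir y ≡ 1# → dir (c * y) ≡ dir c
        dir-along {y} dy = trans (pow-distrib-* c y r) (trans (cong (dir c *_) dy) (*-identityʳ _))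
        along : ∀ {y} → y ≢ 0# → σ y ≡ 1# * y → S (c * y)
        along y≢0 σy = Slope⇒S (subst Slope (sym (dir-along (σ≡⇒dir≡ y≢0 σy))) (S⇒Slope sc))
        c*[x-1] : c * (x - 1#) ≡ c * x - c
        c*[x-1] = trans (*-distribˡ-- c x 1#) (cong (λ z → c * x - z) (*-identityʳ c))
      from : ∀ {w} → Common w × dir w ≡ dir c → dir (reciprocal c * w) ≡ 1# × reciprocal c * w ≢ 1#
      from {w} ((sw , sw-c) , dw) = *-cancelˡ (dir c) (pow-≢0 r c≢0) (begin
          dir c * dir (reciprocal c * w)  ≡⟨ pow-distrib-* c _ r ⟨
          dir (c * (reciprocal c * w))    ≡⟨ cong dir (*-divide w c≢0) ⟩
          dir w                           ≡⟨ dw ⟩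
          dir c                           ≡⟨ *-identityʳ _ ⟨
          dir c * 1#                      ∎)
        , λ e → S⇒≢0 sw-c (x≡y⇒x-y≡0 (trans (sym (*-divide w c≢0)) (trans (cong (c *_) e) (*-identityʳ c))))

    -- The slope of c is not among the t slopes of `S`, so each of the t lines is transversal and
    -- carries t - 1 points, one for each slope v other than its own.
    card-common-∉ : ∀ {n} → t ≡ suc n → ¬ S c → Card Common (t *ℕ n)
    card-common-∉ {n} refl ¬sc = card-fibres dir Slopes.card-roots-of-unity (S⇒Slope ∘ proj₁)
      λ su → card-transversal su (≢dir su)
        (card-cong (λ p → p , ≢dir (proj₁ p)) proj₁ (card-remove su Slopes.card-roots-of-unity))
      where
      ≢dir : ∀ {u} → Slope u → u ≢ dir c
      ≢dir su refl = ¬sc (Slope⇒S su)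

    -- The line through c contributes r - 1 points. Each of the other k = t - 1 lines contributes t
    -- - 2, as v avoids both its own slope and that of c.
    card-common-∈ : ∀ {n k} → r ≡ suc n → t ≡ suc k → S c → Card Common (n +ℕ k *ℕ (k ∸ 1))
    card-common-∈ {n} {k} r≡ refl sc =
      card-cong (λ { (inj₁ (p , _)) → p ; (inj₂ (p , _)) → p }) split
        (card-⊎ (card-parallel r≡ sc)
          (card-fibres dir (card-remove (S⇒Slope sc) Slopes.card-roots-of-unity)
            (λ ((sw , _) , d≢) → S⇒Slope sw , d≢) fibre)
          λ (_ , e) (_ , ne) → ne e)
      where
      split : ∀ {w} → Common w → (Common w × dir w ≡ dir c) ⊎ (Common w × dir w ≢ dir c)
      split {w} p with dir w ≟ dir c
      ... | yes e = inj₁ (p , e)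
      ... | no ne = inj₂ (p , ne)
      fibre : ∀ {u} → Slope u × u ≢ dir c →
        Card (λ w → (Common w × dir w ≢ dir c) × dir w ≡ u) (k ∸ 1)
      fibre {u} (su , u≢) = card-cong
        (λ (p , e) → (p , λ d → u≢ (trans (sym e) d)) , e) (λ ((p , _) , e) → p , e)
        (card-transversal su u≢ (others k refl))
        where
        -- For k = 0 there is a single slope, contradicting the distinct slopes u and `dir c`; hence
        -- the truncation in `k ∸ 1` is harmless.
        others : ∀ j → k ≡ j → Card (λ v → (Slope v × v ≢ u) × v ≢ dir c) (j ∸ 1)
        others zero refl =
          ⊥-elim (card-0⇒∅ (card-remove su Slopes.card-roots-of-unity) (S⇒Slope sc , u≢ ∘ sym))
        others (suc j) refl = card-remove (S⇒Slope sc , u≢ ∘ sym) (card-remove su Slopes.card-roots-of-unity)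

  -- Translation to arbitrary vertices and the graph parameters.

  [x+y]-x≡y : ∀ x y → (x + y) - x ≡ y
  [x+y]-x≡y x y = +-cancelˡ x _ _ (y+[x-y]≡x (x + y) x)

  [z-x]-[y-x]≡z-y : ∀ x y z → (z - x) - (y - x) ≡ z - y
  [z-x]-[y-x]≡z-y x y z = begin
    (z - x) - (y - x)     ≡⟨ cong (z - x +_) (-[x-y]≡y-x y x) ⟩
    (z - x) + (x - y)     ≡⟨ solve 4 (λ x z -x -y → (z :+ -x) :+ (x :+ -y) := (z :+ -y) :+ (x :+ -x)) refl
                               x z (- x) (- y) ⟩
    (z - y) + (x - x)     ≡⟨ cong (z - y +_) (-‿inverseʳ x) ⟩
    (z - y) + 0#          ≡⟨ +-identityʳ _ ⟩
    z - y                 ∎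
    where open ≡-Reasoning

  card-neighbours : ∀ x → Card (λ y → S (y - x)) (t *ℕ r)
  card-neighbours x = card-↔ (x +_) (_- x)
    (λ {d} s → subst S (sym ([x+y]-x≡y x d)) (S-powers.pow≡1⇒InS s)) S-powers.InS⇒pow≡1
    (λ {d} _ → [x+y]-x≡y x d) (λ {y} _ → y+[x-y]≡x y x)
    (card-resp (ℕ.*-comm r t) S-powers.card-roots-of-unity)

  -- Translation by x carries the pair 0, y - x to the pair x, y.
  card-common-neighbours : ∀ {x y n} (x≢y : x ≢ y) → Card (Common (x≢y⇒x-y≢0 (x≢y ∘ sym))) n →
    Card (λ z → S (z - x) × S (z - y)) n
  card-common-neighbours {x} {y} x≢y = card-↔ (x +_) (_- x)
    (λ {w} (sw , sw-c) → subst S (sym ([x+y]-x≡y x w)) sw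
      , subst S (trans (cong (_- (y - x)) (sym ([x+y]-x≡y x w))) ([z-x]-[y-x]≡z-y x y (x + w))) sw-c)
    (λ {z} (szx , szy) → szx , subst S (sym ([z-x]-[y-x]≡z-y x y z)) szy)
    (λ {w} _ → [x+y]-x≡y x w) (λ {z} _ → y+[x-y]≡x z x)

  isSRGLatinSquareType : ∀ {n k} → r ≡ suc n → t ≡ suc k →
    IsSRGLatinSquareType F (λ x y → S (y - x)) (λ x y → InS? F e (y - x))
  isSRGLatinSquareType {n} {k} refl refl =
    -- The order of the square is `suc r`, which is n + 2, so the equation for `e` is only
    -- commutativity of adding 2.
    suc r , t , n +ℕ k *ℕ (k ∸ 1) , s≤s z≤n , s≤s z≤n , ℕ.+-comm _ 2
    , (λ x s → S⇒≢0 s (-‿inverseʳ x))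
    , (λ x y s → subst S (-[x-y]≡y-x y x) (S-neg s))
    , N≡n²
    , (λ x → card⇒count _ (card-neighbours x))
    , (λ x y x≢y s → card⇒count _ (card-common-neighbours x≢y
        (card-common-∈ (x≢y⇒x-y≢0 (x≢y ∘ sym)) refl refl s)))
    , (λ x y x≢y ¬s → card⇒count _ (card-common-neighbours x≢y
        (card-common-∉ (x≢y⇒x-y≢0 (x≢y ∘ sym)) refl ¬s)))

-- Arithmetic of the parameters and the theorem.

1+Q∣1+Q^odd : ∀ Q .{{_ : NonZero Q}} j → ∃ λ k → suc k *ℕ (Q +ℕ 1) ≡ suc (Q ^ suc (2 *ℕ j))
1+Q∣1+Q^odd (suc a) zero = 0 , base a
  where
  base : ∀ a → 1 *ℕ (suc a +ℕ 1) ≡ suc (suc a *ℕ 1)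
  base = solve-∀
1+Q∣1+Q^odd (suc a) (suc j) with 1+Q∣1+Q^odd (suc a) j
-- With a = Q - 1 and P = Q^(2j+1), one has Q² P + 1 = (P + 1) + a (Q + 1) P, so the quotient by Q +
-- 1 grows by a P.
... | k , eq = k +ℕ a *ℕ P , (begin
  suc (k +ℕ a *ℕ P) *ℕ (suc a +ℕ 1)                         ≡⟨ distribute k a P ⟩
  suc k *ℕ (suc a +ℕ 1) +ℕ a *ℕ P *ℕ (suc a +ℕ 1)           ≡⟨ cong (_+ℕ a *ℕ P *ℕ (suc a +ℕ 1)) eq ⟩
  suc P +ℕ a *ℕ P *ℕ (suc a +ℕ 1)                           ≡⟨ collect a P ⟩
  suc (suc a ^ suc (2 +ℕ 2 *ℕ j))                           ≡⟨ cong (λ z → suc (suc a ^ suc z)) (ℕ.*-suc 2 j) ⟨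
  suc (suc a ^ suc (2 *ℕ suc j))                            ∎)
  where
  open ≡-Reasoning
  P = suc a ^ suc (2 *ℕ j)
  distribute : ∀ k a P →
    suc (k +ℕ a *ℕ P) *ℕ (suc a +ℕ 1) ≡ suc k *ℕ (suc a +ℕ 1) +ℕ a *ℕ P *ℕ (suc a +ℕ 1)
  distribute = solve-∀
  collect : ∀ a P → suc P +ℕ a *ℕ P *ℕ (suc a +ℕ 1) ≡ suc (suc a *ℕ (suc a *ℕ P))
  collect = solve-∀

1<m^n : ∀ {m n} → 1 < m → 1 ≤ n → 1 < m ^ n
1<m^n {m} {n} 1<m 1≤n = ℕ.<-≤-trans 1<m
  (subst (_≤ m ^ n) (ℕ.*-identityʳ m) (ℕ.^-monoʳ-≤ m {{>-nonZero (ℕ.<⇒≤ 1<m)}} 1≤n))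

>1⇒≡2+ : ∀ {x} → 1 < x → ∃ λ n → x ≡ suc (suc n)
>1⇒≡2+ (s≤s (s≤s {n = n} _)) = n , refl

theorem5p4 : (q m ℓ : ℕ) → .{{_ : NonZero ℓ}} → PrimePower q → 1 ≤ m → 1 ≤ ℓ
    → ℓ ∣ m → Even (m / ℓ) → ¬ (ℓ ≡ m / 2) → Odd ((m / ℓ) / 2)
    → (F : FiniteField (q ^ m))
    → IsSRGLatinSquareType F (CayleyAdj F q ℓ) (CayleyAdj? F q ℓ)
theorem5p4 q m ℓ (p , i , p-prime , 1≤i , q≡p^i) _ 1≤ℓ (divides d m≡dℓ) (s , m/ℓ≡2s) _ (j , odd) F =
  LatinSquareGraph.isSRGLatinSquareType F (suc n) (suc k) (q ^ ℓ +ℕ 1) q^m≡ t*e≡ σ-+ refl refl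
  where
  open ≡-Reasoning
  open FieldTheory F using (pow; Additive)

  m≡2sℓ : m ≡ 2 *ℕ s *ℕ ℓ
  m≡2sℓ = trans m≡dℓ (cong (_*ℕ ℓ) (trans (sym (trans (cong (_/ ℓ) m≡dℓ) (m*n/n≡m d ℓ))) m/ℓ≡2s))

  s≡2j+1 : s ≡ suc (2 *ℕ j)
  s≡2j+1 = begin
    s                 ≡⟨ m*n/n≡m s 2 ⟨
    s *ℕ 2 / 2        ≡⟨ cong (_/ 2) (trans (ℕ.*-comm s 2) (sym m/ℓ≡2s)) ⟩
    (m / ℓ) / 2       ≡⟨ odd ⟩
    suc (2 *ℕ j)      ∎

  1<q^ℓ : 1 < q ^ ℓ
  1<q^ℓ = 1<m^n (subst (1 <_) (sym q≡p^i) (1<m^n (nonTrivial⇒n>1 p {{prime⇒nonTrivial p-prime}}) 1≤i)) 1≤ℓ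

  instance
    _ = >-nonZero (ℕ.<⇒≤ 1<q^ℓ)
    _ = >-nonZero (ℕ.m≤n+m 1 (q ^ ℓ))

  -- The order of K is Q^s = n + 2; writing two successors makes both r = n + 1 and r - 1 explicit.
  root : ∃ λ n → (q ^ ℓ) ^ s ≡ suc (suc n)
  root = >1⇒≡2+ (1<m^n 1<q^ℓ (subst (1 ≤_) (sym s≡2j+1) (s≤s z≤n)))
  n = proj₁ root
  k = proj₁ (1+Q∣1+Q^odd (q ^ ℓ) j)

  t*e≡ : suc k *ℕ (q ^ ℓ +ℕ 1) ≡ suc (suc (suc n))
  t*e≡ = trans (proj₂ (1+Q∣1+Q^odd (q ^ ℓ) j))
    (cong suc (trans (cong ((q ^ ℓ) ^_) (sym s≡2j+1)) (proj₂ root)))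

  q^m≡ : q ^ m ≡ suc (suc n) *ℕ suc (suc n)
  q^m≡ = begin
    q ^ m                             ≡⟨ cong (q ^_) (trans m≡2sℓ (double s ℓ)) ⟩
    q ^ (ℓ *ℕ s +ℕ ℓ *ℕ s)            ≡⟨ ℕ.^-distribˡ-+-* q (ℓ *ℕ s) (ℓ *ℕ s) ⟩
    q ^ (ℓ *ℕ s) *ℕ q ^ (ℓ *ℕ s)      ≡⟨ cong (λ z → z *ℕ z) (trans (sym (ℕ.^-*-assoc q ℓ s)) (proj₂ root)) ⟩
    suc (suc n) *ℕ suc (suc n)        ∎
    where
    double : ∀ s ℓ → 2 *ℕ s *ℕ ℓ ≡ ℓ *ℕ s +ℕ ℓ *ℕ s
    double = solve-∀

  p^≡ : ∀ a → q ^ a ≡ p ^ (i *ℕ a)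
  p^≡ a = trans (cong (_^ a) q≡p^i) (ℕ.^-*-assoc p i a)

  -- Since Q^s = p^(iℓs), the map is an iterate of the Frobenius map.
  σ-+ : Additive (λ x → pow x (suc (suc n)))
  σ-+ = subst (λ N → Additive (λ x → pow x N))
    (trans (sym (p^≡ (ℓ *ℕ s))) (trans (sym (ℕ.^-*-assoc q ℓ s)) (proj₂ root)))
    (FieldTheory.Characteristic.frobenius-+ F {j = i *ℕ m} p-prime (p^≡ m) (i *ℕ (ℓ *ℕ s)))
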